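{- The problem of deciding, for a given TPTL formula, whether it is equivalent to some $\mathrm{TPTL}_{=}$ formula is undecidable; likewise, the problem of deciding whether a given TPTL formula is equivalent to some $\mathrm{TPTL}_{\mathrm{un}}$ formula is undecidable.
   Context: Data words: infinite sequences $(P_0,d_0)(P_1,d_1)\dots$ with $P_i\subseteq\mathcal{P}$ (finite set of propositions) and $d_i\in\mathbb{N}$. Intervals are integer intervals with endpoints in $\mathbb{Z}\cup\{\pm\infty\}$. TPTL: $\varphi::=p\mid x\in I\mid\neg\varphi\mid\varphi_1\wedge\varphi_2\mid\varphi_1\mathsf{U}\varphi_2\mid x.\varphi$; $(w,i,\nu)\models p$ iff $p\in P_i$; $(w,i,\nu)\models x\in I$ iff $d_i-\nu(x)\in I$; $(w,i,\nu)\models x.\varphi$ iff $(w,i,\nu[x\mapsto d_i])\models\varphi$; $(w,i,\nu)\models\varphi_1\mathsf{U}\varphi_2$ iff there is $j>i$ with $(w,j,\nu)\models\varphi_2$ and $(w,k,\nu)\models\varphi_1$ for all $i<k<j$; $w\models\varphi$ iff $(w,0,\nu_0)\models\varphi$ with $\nu_0$ mapping all registers to $d_0$. $\mathsf{F}\varphi:=\mathrm{true}\,\mathsf{U}\,\varphi$, $\mathsf{X}\varphi:=\mathrm{false}\,\mathsf{U}\,\varphi$. $\mathrm{TPTL}_{=}$: TPTL formulas in which every constraint $x\in I$ has $I=[0,0]$. $\mathrm{TPTL}_{\mathrm{un}}$: formulas of the grammar $\varphi::=p\mid\neg\varphi\mid x\in I\mid\varphi_1\wedge\varphi_2\mid\mathsf{F}\varphi\mid\mathsf{X}\varphi\mid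 x.\varphi$. Equivalence: same set of satisfying data words. -}

module Defs where

open import Data.Nat using (ℕ; zero; suc; _<_)
open import Data.Integer using (ℤ; +_; _-_; _≤_; 0ℤ)
open import Data.Fin using (Fin; zero; suc)
open import Data.Fin.Subset using (Subset; _∈_)
open import Data.Maybe using (Maybe; just; nothing; _>>=_)
open import Data.Product using (Σ; ∃; ∃-syntax; _×_; _,_)
open import Data.Unit using (⊤)
open import Data.Vec using (Vec; lookup)
open import Relation.Nullary using (¬_)
open import Relation.Binary.PropositionalEquality using (_≡_)
open import Function.Bundles using (_⇔_)

-- Over the integers every interval (open / half-open / closed) equals
-- one with closed finite endpoints, so we represent an interval by an
-- optional lower bound (nothing = -∞) and optional upper bound
-- (nothing = +∞), both inclusive.

record Interval : Set where
  constructor ⟦_,_⟧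
  field
    lower : Maybe ℤ
    upper : Maybe ℤ

LowerOK : Maybe ℤ → ℤ → Set
LowerOK nothing  z = ⊤
LowerOK (just a) z = a ≤ z

UpperOK : Maybe ℤ → ℤ → Set
UpperOK nothing  z = ⊤
UpperOK (just b) z = z ≤ b

_∈I_ : ℤ → Interval → Set
z ∈I ⟦ l , u ⟧ = LowerOK l z × UpperOK u z

[0,0] : Interval
[0,0] = ⟦ just 0ℤ , just 0ℤ ⟧

[-∞,∞] : Interval
[-∞,∞] = ⟦ nothing , nothing ⟧

record DataWord (n : ℕ) : Set where
  field
    props : ℕ → Subset n
    datum : ℕ → ℕ
open DataWord public

Register : Set
Register = ℕ

Valuation : Set
Valuation = Register → ℕ

_[_↦_] : Valuation → Register → ℕ → Valuation
(ν [ x ↦ v ]) y with Data.Nat._≟_ x y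
... | Relation.Nullary.yes _ = v
... | Relation.Nullary.no  _ = ν y
  where open import Data.Nat
        open import Relation.Nullary

data Formula (n : ℕ) : Set where
  prop   : Fin n → Formula n
  _∈ᶜ_   : Register → Interval → Formula n
  ~_     : Formula n → Formula n
  _∧_    : Formula n → Formula n → Formula n
  _U_    : Formula n → Formula n → Formula n
  frz    : Register → Formula n → Formula n

Sat : {n : ℕ} → DataWord n → ℕ → Valuation → Formula n → Set
Sat w i ν (prop p)   = p ∈ props w i
Sat w i ν (x ∈ᶜ I)   = ((+ datum w i) - (+ ν x)) ∈I I
Sat w i ν (~ φ)      = ¬ Sat w i ν φ
Sat w i ν (φ ∧ ψ)    = Sat w i ν φ × Sat w i ν ψ
Sat w i ν (φ U ψ)    =
  ∃[ j ] (i < j × Sat w j ν ψ × ((k : ℕ) → i < k → k < j → Sat w k ν φ))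
Sat w i ν (frz x φ)  = Sat w i (ν [ x ↦ datum w i ]) φ

_⊨_ : {n : ℕ} → DataWord n → Formula n → Set
w ⊨ φ = Sat w 0 (λ _ → datum w 0) φ

_≋_ : {n : ℕ} → Formula n → Formula n → Set
φ ≋ ψ = ∀ w → (w ⊨ φ) ⇔ (w ⊨ ψ)

true false : {n : ℕ} → Formula n
true  = 0 ∈ᶜ [-∞,∞]
false = ~ true

𝐅 𝐗 : {n : ℕ} → Formula n → Formula n
𝐅 φ = true U φ
𝐗 φ = false U φ

data IsTPTL₌ {n : ℕ} : Formula n → Set where
  prop : ∀ p → IsTPTL₌ (prop p)
  eq   : ∀ x → IsTPTL₌ (x ∈ᶜ [0,0])
  neg  : ∀ {φ} → IsTPTL₌ φ → IsTPTL₌ (~ φ)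
  conj : ∀ {φ ψ} → IsTPTL₌ φ → IsTPTL₌ ψ → IsTPTL₌ (φ ∧ ψ)
  until : ∀ {φ ψ} → IsTPTL₌ φ → IsTPTL₌ ψ → IsTPTL₌ (φ U ψ)
  frz  : ∀ x {φ} → IsTPTL₌ φ → IsTPTL₌ (frz x φ)

EquivToTPTL₌ : {n : ℕ} → Formula n → Set
EquivToTPTL₌ {n} φ = Σ (Formula n) λ ψ → IsTPTL₌ ψ × (φ ≋ ψ)

data FormulaUn (n : ℕ) : Set where
  prop : Fin n → FormulaUn n
  ~_   : FormulaUn n → FormulaUn n
  _∈ᶜ_ : Register → Interval → FormulaUn n
  _∧_  : FormulaUn n → FormulaUn n → FormulaUn n
  F    : FormulaUn n → FormulaUn n
  X    : FormulaUn n → FormulaUn n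
  frz  : Register → FormulaUn n → FormulaUn n

⌜_⌝ : {n : ℕ} → FormulaUn n → Formula n
⌜ prop p ⌝  = prop p
⌜ ~ φ ⌝     = ~ ⌜ φ ⌝
⌜ x ∈ᶜ I ⌝  = x ∈ᶜ I
⌜ φ ∧ ψ ⌝   = ⌜ φ ⌝ ∧ ⌜ ψ ⌝
⌜ F φ ⌝     = 𝐅 ⌜ φ ⌝
⌜ X φ ⌝     = 𝐗 ⌜ φ ⌝
⌜ frz x φ ⌝ = frz x ⌜ φ ⌝

EquivToTPTLun : {n : ℕ} → Formula n → Set
EquivToTPTLun {n} φ = Σ (FormulaUn n) λ ψ → φ ≋ ⌜ ψ ⌝

-- Reference undecidable problem: halting of two-counter (Minsky)
-- machines started in label 0 with both counters 0.

data Instr (m : ℕ) : Set where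
  inc   : Fin 2 → Fin m → Instr m
  jzdec : Fin 2 → Fin m → Fin m → Instr m     -- if c = 0 goto k else (c-- ; goto j)
  halt  : Instr m

Machine : ℕ → Set
Machine m = Vec (Instr (suc m)) (suc m)

Config : ℕ → Set
Config m = Fin (suc m) × ℕ × ℕ

getC : Fin 2 → ℕ × ℕ → ℕ
getC zero    (a , b) = a
getC (suc _) (a , b) = b

setC : Fin 2 → ℕ → ℕ × ℕ → ℕ × ℕ
setC zero    v (a , b) = v , b
setC (suc _) v (a , b) = a , v

step : {m : ℕ} → Machine m → Config m → Maybe (Config m)
step M (l , cs) with lookup M l
... | inc c j     = just (j , setC c (suc (getC c cs)) cs)
... | jzdec c j k with getC c cs
...   | zero  = just (k , cs)
...   | suc v = just (j , setC c v cs)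
step M (l , cs) | halt = nothing

run : {m : ℕ} → Machine m → ℕ → Config m → Maybe (Config m)
run M zero    c = just c
run M (suc k) c = step M c >>= run M k

Halts : {m : ℕ} → Machine m → Set
Halts M = ∃[ k ] ∃[ c ] (run M k (zero , 0 , 0) ≡ just c × step M c ≡ nothing)

-- Synthetic undecidability: a predicate on (all) TPTL formulas is
-- undecidable if deciding it would decide two-counter-machine halting.

open import Relation.Nullary using (Dec)

DecidesTPTL : ((n : ℕ) → Formula n → Set) → Set
DecidesTPTL P = (n : ℕ) (φ : Formula n) → Dec (P n φ)

DecidesHalting : Set
DecidesHalting = (m : ℕ) (M : Machine m) → Dec (Halts M)

UndecidableTPTL : ((n : ℕ) → Formula n → Set) → Set
UndecidableTPTL P = DecidesTPTL P → DecidesHalting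

-- Both problems are reduced from the halting problem of two-counter
-- machines.  A configuration (l , c₁ , c₂) of M is encoded at two consecutive
-- positions: the proposition for l, and the data d₀ + 2c₁, d₀ + 2c₂, where d₀
-- is the first datum.  The formula `ok` says that a labelled position is
-- followed by the encoding of the successor configuration, and Init says that
-- the initial configuration occurs.  For any θ, Init ∧ 𝐅 (ok ⇒ θ) is
-- equivalent to Init when M halts, since then every model of Init breaks the
-- encoding somewhere; and Init is equivalent to a formula of either fragment.
-- If θ fails on correct encodings, the converse comes from two words that the
-- fragment cannot distinguish: one satisfies θ early, the other encodes the
-- run of M faithfully, so an equivalent fragment formula forces ok to fail in
-- the faithful encoding, i.e. M halts.
--   TPTL₌:   θ₁ asks for a datum at distance 1 from d₀; doubling all data
--            preserves TPTL₌ and removes every such datum.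
--   TPTL_un: θ₂ = 𝖼 ∧ (a U 𝖻); the words start with a long sequence of blocks
--            𝖼 aᵏ 𝖽 aᵏ 𝖻 aᵏ …, where a single 𝖽 𝖻 pair is exchanged;
--            F and X of bounded depth cannot detect the exchange (an
--            Ehrenfeucht–Fraïssé argument).

module Submission where

open import Defs
open import Data.Product using (_×_)

open import Data.Empty using (⊥; ⊥-elim)
open import Data.Fin using (Fin; zero; suc)
open import Data.Fin.Properties using (¬∀⟶∃¬)
open import Data.Fin.Subset as Subset using (Subset; _∈_; ⁅_⁆)
open import Data.Fin.Subset.Properties using (_∈?_; ∉⊥; x∈⁅x⁆; x∈⁅y⁆⇒x≡y)
open import Data.Integer as ℤ using (ℤ; +_; -[1+_]; 0ℤ; _-_; _⊖_)
import Data.Integer.Properties as ℤ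
open import Data.Maybe using (Maybe; just; nothing; _>>=_)
open import Data.Nat as ℕ using (ℕ; zero; suc; _+_; _*_; _∸_; _<_; _≤_; z≤n; s≤s)
import Data.Nat.Properties as ℕ
open import Data.Nat.DivMod
  using (_%_; _/_; m%n<n; m≡m%n+[m/n]*n; [m+kn]%n≡m%n; m<n⇒m%n≡m; m*n/n≡m; /-monoˡ-≤)
open import Data.Product using (Σ; ∃-syntax; _,_; proj₁; proj₂)
open import Data.Product.Function.NonDependent.Propositional using (_×-⇔_)
open import Data.Sum using (_⊎_; inj₁; inj₂)
open import Data.Unit using (tt)
open import Data.Vec using (lookup)
open import Function using (_∘_; _$_; case_of_; _⇔_; mk⇔; Equivalence)
open import Function.Definitions using (Injective)
import Function.Properties.Equivalence as ⇔
open import Relation.Binary.PropositionalEquality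
  using (_≡_; _≢_; refl; sym; trans; cong; cong₂; subst)
open import Relation.Nullary using (¬_; Dec; yes; no)
open import Relation.Nullary.Decidable using (map′; ¬?; _×-dec_; decidable-stable)
open import Algebra.Properties.AbelianGroup ℤ.+-0-abelianGroup using (∙-cancelʳ)

open Equivalence using (to; from)

private
  variable
    n k : ℕ
    φ ψ χ : Formula n

ν₀ : DataWord n → Valuation
ν₀ w _ = datum w 0

_⇒_ : Formula n → Formula n → Formula n
φ ⇒ ψ = ~ (φ ∧ (~ ψ))

if_then_else_ : Formula n → Formula n → Formula n → Formula n
if φ then ψ else χ = (φ ⇒ ψ) ∧ ((~ φ) ⇒ χ)

⋀ : (Fin k → Formula n) → Formula n
⋀ {k = zero}  φs = true
⋀ {k = suc k} φs = φs zero ∧ ⋀ (φs ∘ suc)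

point : ℤ → Interval
point z = ⟦ just z , just z ⟧

∈-point : ∀ {z z′} → z ∈I point z′ ⇔ z ≡ z′
∈-point = mk⇔ (λ (z′≤z , z≤z′) → ℤ.≤-antisym z≤z′ z′≤z) (λ { refl → ℤ.≤-refl , ℤ.≤-refl })

Sat-true : (w : DataWord n) (i : ℕ) (ν : Valuation) → Sat w i ν true
Sat-true w i ν = tt , tt

Sat-𝐗 : (w : DataWord n) (i : ℕ) (ν : Valuation) (φ : Formula n) →
        Sat w i ν (𝐗 φ) ⇔ Sat w (suc i) ν φ
Sat-𝐗 w i ν φ =
  mk⇔ next⇒ (λ s → suc i , ℕ.≤-refl , s , λ k i<k k<1+i → ⊥-elim (ℕ.<⇒≱ k<1+i i<k))
  where
  next⇒ : Sat w i ν (𝐗 φ) → Sat w (suc i) ν φ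
  next⇒ (j , i<j , s , between) with ℕ.m≤n⇒m<n∨m≡n i<j
  ... | inj₂ refl  = s
  ... | inj₁ 1+i<j = ⊥-elim (between (suc i) ℕ.≤-refl 1+i<j (Sat-true w (suc i) ν))

Sat-⋀ : (w : DataWord n) (i : ℕ) (ν : Valuation) (φs : Fin k → Formula n) →
        Sat w i ν (⋀ φs) ⇔ (∀ l → Sat w i ν (φs l))
Sat-⋀ {k = zero}  w i ν φs = mk⇔ (λ _ ()) (λ _ → Sat-true w i ν)
Sat-⋀ {k = suc k} w i ν φs =
  mk⇔ (λ (s , ss) → λ { zero → s ; (suc l) → to (Sat-⋀ w i ν (φs ∘ suc)) ss l })
      (λ ss → ss zero , from (Sat-⋀ w i ν (φs ∘ suc)) (ss ∘ suc))

-- Satisfaction of a formula that looks ahead only through 𝐗 is decidable,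
-- which is what allows classical reasoning about _⇒_ in the encoding.
data Local {n} : Formula n → Set where
  prop : ∀ p → Local (prop p)
  cst  : ∀ x I → Local (x ∈ᶜ I)
  neg  : Local φ → Local (~ φ)
  conj : Local φ → Local ψ → Local (φ ∧ ψ)
  frz  : ∀ x → Local φ → Local (frz x φ)
  next : Local φ → Local (𝐗 φ)

local-⋀ : {φs : Fin k → Formula n} → (∀ l → Local (φs l)) → Local (⋀ φs)
local-⋀ {k = zero}  _  = cst 0 _
local-⋀ {k = suc k} ls = conj (ls zero) (local-⋀ (ls ∘ suc))

_∈I?_ : ∀ z I → Dec (z ∈I I)
z ∈I? ⟦ l , u ⟧ = lower? l ×-dec upper? u
  where
  lower? : ∀ l → Dec (LowerOK l z)
  lower? nothing  = yes tt
  lower? (just a) = a ℤ.≤? z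
  upper? : ∀ u → Dec (UpperOK u z)
  upper? nothing  = yes tt
  upper? (just b) = z ℤ.≤? b

sat? : (w : DataWord n) (i : ℕ) (ν : Valuation) → Local φ → Dec (Sat w i ν φ)
sat? w i ν (prop p)         = p ∈? props w i
sat? w i ν (cst x I)        = _ ∈I? I
sat? w i ν (neg l)          = ¬? (sat? w i ν l)
sat? w i ν (conj l l′)      = sat? w i ν l ×-dec sat? w i ν l′
sat? w i ν (frz x l)        = sat? w i _ l
sat? w i ν (next {φ = φ} l) = map′ (from (Sat-𝐗 w i ν φ)) (to (Sat-𝐗 w i ν φ)) (sat? w (suc i) ν l)

module _ (w : DataWord n) (i : ℕ) (ν : Valuation) where

  ⇒-elim : (φ : Formula n) → Local ψ → Sat w i ν φ → Sat w i ν (φ ⇒ ψ) → Sat w i ν ψ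
  ⇒-elim φ l s s⇒ = decidable-stable (sat? w i ν l) (λ ¬t → s⇒ (s , ¬t))

  if-true : (φ ψ χ : Formula n) → Local ψ → Sat w i ν φ →
            Sat w i ν (if φ then ψ else χ) ⇔ Sat w i ν ψ
  if-true φ ψ χ l s =
    mk⇔ (λ (s⇒ , _) → ⇒-elim φ l s s⇒) (λ t → (λ (_ , ¬t) → ¬t t) , (λ (¬s , _) → ¬s s))

  if-false : (φ ψ χ : Formula n) → Local χ → ¬ Sat w i ν φ →
             Sat w i ν (if φ then ψ else χ) ⇔ Sat w i ν χ
  if-false φ ψ χ l ¬s =
    mk⇔ (λ (_ , s⇒) → ⇒-elim (~ φ) l ¬s s⇒) (λ t → (λ (s , _) → ¬s s) , (λ (_ , ¬t) → ¬t t))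

wordOf : (ℕ → Subset n × ℕ) → DataWord n
wordOf s = record { props = proj₁ ∘ s ; datum = proj₂ ∘ s }

mapData : (ℕ → ℕ) → DataWord n → DataWord n
mapData f w = record { props = props w ; datum = f ∘ datum w }

splice : {A : Set} → ℕ → (ℕ → A) → (ℕ → A) → ℕ → A
splice G u v p with p ℕ.<? G
... | yes _ = u p
... | no  _ = v (p ∸ G)

module SpliceLemmas {A : Set} {G : ℕ} {u v : ℕ → A} where

  splice-< : ∀ {p} → p < G → splice G u v p ≡ u p
  splice-< {p} p<G with p ℕ.<? G
  ... | yes _   = refl
  ... | no  p≮G = ⊥-elim (p≮G p<G)

  splice-≥ : ∀ {p} → G ≤ p → splice G u v p ≡ v (p ∸ G)
  splice-≥ {p} G≤p with p ℕ.<? G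
  ... | yes p<G = ⊥-elim (ℕ.<⇒≱ p<G G≤p)
  ... | no  _   = refl

  splice-+ : ∀ q → splice G u v (G + q) ≡ v q
  splice-+ q = trans (splice-≥ (ℕ.m≤m+n G q)) (cong v (ℕ.m+n∸m≡n G q))

[d+m]-[d+n]≡m⊖n : ∀ d m n → + (d + m) - + (d + n) ≡ m ⊖ n
[d+m]-[d+n]≡m⊖n d m n = trans (ℤ.[+m]-[+n]≡m⊖n (d + m) (d + n)) (ℤ.+-cancelˡ-⊖ d m n)

offset-⇔ : ∀ {a b} d x y → b ≡ d + x → (+ a - + b ≡ y ⊖ x) ⇔ a ≡ d + y
offset-⇔ {a} d x y refl = mk⇔
  (λ e → ℤ.+-injective (∙-cancelʳ (ℤ.- + (d + x)) (+ a) (+ (d + y))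
                          (trans e (sym ([d+m]-[d+n]≡m⊖n d y x)))))
  (λ { refl → [d+m]-[d+n]≡m⊖n d y x })

diff≡0-⇔ : ∀ {a b} → + a - + b ≡ 0ℤ ⇔ a ≡ b
diff≡0-⇔ {a} {b} = mk⇔
  (λ e → ℤ.+-injective (∙-cancelʳ (ℤ.- + b) (+ a) (+ b) (trans e (sym (ℤ.+-inverseʳ (+ b))))))
  (λ { refl → ℤ.+-inverseʳ (+ b) })

∈[0,0]-⇔ : ∀ {a b} → (+ a - + b) ∈I [0,0] ⇔ a ≡ b
∈[0,0]-⇔ = ⇔.trans ∈-point diff≡0-⇔

double : ℕ → ℕ
double zero    = zero
double (suc m) = suc (suc (double m))

double-injective : Injective _≡_ _≡_ double
double-injective {zero}  {zero}  _ = refl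
double-injective {suc m} {suc n} e = cong suc (double-injective (ℕ.suc-injective (ℕ.suc-injective e)))

double≢1 : ∀ m → double m ≢ 1
double≢1 zero    ()
double≢1 (suc m) ()

m+double[1+n] : ∀ m n → m + double (suc n) ≡ 2 + (m + double n)
m+double[1+n] m n = trans (ℕ.+-suc m _) (cong suc (ℕ.+-suc m _))

[2+m]⊖m≡2 : ∀ m → suc (suc m) ⊖ m ≡ + 2
[2+m]⊖m≡2 zero    = refl
[2+m]⊖m≡2 (suc m) = trans (ℤ.[1+m]⊖[1+n]≡m⊖n (suc (suc m)) m) ([2+m]⊖m≡2 m)

m⊖[2+m]≡-2 : ∀ m → m ⊖ suc (suc m) ≡ -[1+ 1 ]
m⊖[2+m]≡-2 zero    = refl
m⊖[2+m]≡-2 (suc m) = trans (ℤ.[1+m]⊖[1+n]≡m⊖n m (suc (suc m))) (m⊖[2+m]≡-2 m)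

module Encoding {m : ℕ} (M : Machine m) where

  initial : Config m
  initial = zero , 0 , 0

  configuration : ℕ → Maybe (Config m)
  configuration t = run M t initial

  run-suc : ∀ t c → run M (suc t) c ≡ (run M t c >>= step M)
  run-suc zero c with step M c
  ... | nothing = refl
  ... | just _  = refl
  run-suc (suc t) c with step M c
  ... | nothing = refl
  ... | just c′ = run-suc t c′

  configuration-suc : ∀ t {c} → configuration t ≡ just c → configuration (suc t) ≡ step M c
  configuration-suc t e = trans (run-suc t initial) (cong (_>>= step M) e)

  configuration-pred : ∀ t {c} → configuration (suc t) ≡ just c →
                       ∃[ c₀ ] (configuration t ≡ just c₀ × step M c₀ ≡ just c)
  configuration-pred t e = bind≡just (configuration t) (trans (sym (run-suc t initial)) e)
    where
    bind≡just : ∀ (x : Maybe (Config m)) {c} → (x >>= step M) ≡ just c →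
                ∃[ c₀ ] (x ≡ just c₀ × step M c₀ ≡ just c)
    bind≡just (just c₀) e = c₀ , refl , e

  -- Four propositions are reserved for the gadget of the second reduction.
  P : ℕ
  P = 4 + suc m

  label : Fin (suc m) → Fin P
  label l = suc (suc (suc (suc l)))

  data Encodes (w : DataWord P) (d₀ q : ℕ) : Config m → Set where
    encodes : ∀ {l c₁ c₂} → label l ∈ props w q → datum w q ≡ d₀ + double c₁ →
              datum w (suc q) ≡ d₀ + double c₂ → Encodes w d₀ q (l , c₁ , c₂)

  counterAt : Fin 2 → ℕ → ℕ
  counterAt zero    q = q
  counterAt (suc _) q = suc q

  move : Fin (suc m) → ℤ → ℤ → Formula P
  move j δ₁ δ₂ = frz 1 (𝐗 (𝐗 (prop (label j) ∧ (1 ∈ᶜ point δ₁))))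
               ∧ 𝐗 (frz 1 (𝐗 (𝐗 (1 ∈ᶜ point δ₂))))

  moveAlong : Fin 2 → ℤ → Fin (suc m) → Formula P
  moveAlong zero    δ j = move j δ 0ℤ
  moveAlong (suc _) δ j = move j 0ℤ δ

  isZero : Fin 2 → Formula P
  isZero zero    = 0 ∈ᶜ [0,0]
  isZero (suc _) = 𝐗 (0 ∈ᶜ [0,0])

  instruction : Instr (suc m) → Formula P
  instruction (inc c j)     = moveAlong c (+ 2) j
  instruction (jzdec c j k) = if isZero c then move k 0ℤ 0ℤ else moveAlong c -[1+ 1 ] j
  instruction halt          = false

  labelled : Fin (suc m) → Formula P
  labelled l = prop (label l) ⇒ instruction (lookup M l)

  ok : Formula P
  ok = ⋀ labelled

  local-move : ∀ j δ₁ δ₂ → Local (move j δ₁ δ₂)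
  local-move j δ₁ δ₂ = conj (frz 1 (next (next (conj (prop _) (cst 1 _)))))
                            (next (frz 1 (next (next (cst 1 _)))))

  local-moveAlong : ∀ c δ j → Local (moveAlong c δ j)
  local-moveAlong zero    δ j = local-move j δ 0ℤ
  local-moveAlong (suc _) δ j = local-move j 0ℤ δ

  local-isZero : ∀ c → Local (isZero c)
  local-isZero zero    = cst 0 _
  local-isZero (suc _) = next (cst 0 _)

  local-instruction : ∀ ι → Local (instruction ι)
  local-instruction (inc c j)     = local-moveAlong c _ j
  local-instruction (jzdec c j k) =
    conj (neg (conj (local-isZero c) (neg (local-move k _ _))))
         (neg (conj (neg (local-isZero c)) (neg (local-moveAlong c _ j))))
  local-instruction halt          = neg (cst 0 _)

  local-labelled : ∀ l → Local (labelled l)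
  local-labelled l = neg (conj (prop (label l)) (neg (local-instruction (lookup M l))))

  local-ok : Local ok
  local-ok = local-⋀ local-labelled

  module _ (w : DataWord P) (q : ℕ) (ν : Valuation) where

    encodes-counter : ∀ {d₀ l} cs c → Encodes w d₀ q (l , cs) →
                      datum w (counterAt c q) ≡ d₀ + double (getC c cs)
    encodes-counter _ zero    (encodes _ e _) = e
    encodes-counter _ (suc _) (encodes _ _ e) = e

    Sat-move : ∀ j δ₁ δ₂ → Sat w q ν (move j δ₁ δ₂) ⇔
               (label j ∈ props w (2 + q)
                × + datum w (2 + q) - + datum w q ≡ δ₁
                × + datum w (3 + q) - + datum w (suc q) ≡ δ₂)
    Sat-move j δ₁ δ₂ = mk⇔
      (λ (s₁ , s₂) → let (p , d₁) = to (X² q ν₁ here) s₁ in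
         p , to ∈-point d₁ , to ∈-point (to (X² (suc q) ν₂ there) (to (Sat-𝐗 w q ν second) s₂)))
      (λ (p , e₁ , e₂) → from (X² q ν₁ here) (p , from ∈-point e₁) ,
         from (Sat-𝐗 w q ν second) (from (X² (suc q) ν₂ there) (from ∈-point e₂)))
      where
      ν₁ ν₂ : Valuation
      ν₁ = ν [ 1 ↦ datum w q ]
      ν₂ = ν [ 1 ↦ datum w (suc q) ]
      here there second : Formula P
      here   = prop (label j) ∧ (1 ∈ᶜ point δ₁)
      there  = 1 ∈ᶜ point δ₂
      second = frz 1 (𝐗 (𝐗 there))
      X² : ∀ i ν′ φ → Sat w i ν′ (𝐗 (𝐗 φ)) ⇔ Sat w (2 + i) ν′ φ
      X² i ν′ φ = ⇔.trans (Sat-𝐗 w i ν′ (𝐗 φ)) (Sat-𝐗 w (suc i) ν′ φ)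

    move-⇔ : ∀ {d₀ l c₁ c₂ c₁′ c₂′ δ₁ δ₂} j → Encodes w d₀ q (l , c₁ , c₂) →
             δ₁ ≡ double c₁′ ⊖ double c₁ → δ₂ ≡ double c₂′ ⊖ double c₂ →
             Sat w q ν (move j δ₁ δ₂) ⇔ Encodes w d₀ (2 + q) (j , c₁′ , c₂′)
    move-⇔ {d₀} {c₁ = c₁} {c₂} {c₁′} {c₂′} j (encodes _ e₁ e₂) refl refl =
      ⇔.trans (Sat-move j _ _) (mk⇔
        (λ (p , f₁ , f₂) → encodes p (to (offset₁ e₁) f₁) (to (offset₂ e₂) f₂))
        (λ { (encodes p f₁ f₂) → p , from (offset₁ e₁) f₁ , from (offset₂ e₂) f₂ }))
      where
      offset₁ = offset-⇔ d₀ (double c₁) (double c₁′)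
      offset₂ = offset-⇔ d₀ (double c₂) (double c₂′)

    moveAlong-⇔ : ∀ {d₀ l c₁ c₂ u v δ} c j → Encodes w d₀ q (l , c₁ , c₂) →
                  getC c (c₁ , c₂) ≡ u → δ ≡ double v ⊖ double u →
                  Sat w q ν (moveAlong c δ j) ⇔ Encodes w d₀ (2 + q) (j , setC c v (c₁ , c₂))
    moveAlong-⇔ {c₂ = c₂} zero    j enc refl eδ = move-⇔ j enc eδ (sym (ℤ.n⊖n≡0 (double c₂)))
    moveAlong-⇔ {c₁ = c₁} (suc _) j enc refl eδ = move-⇔ j enc (sym (ℤ.n⊖n≡0 (double c₁))) eδ

    isZero-⇔ : ∀ {l} cs c → Encodes w (ν 0) q (l , cs) → Sat w q ν (isZero c) ⇔ getC c cs ≡ 0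
    isZero-⇔ cs c enc = ⇔.trans (Sat-isZero c) (mk⇔
      (λ e → double-injective (ℕ.+-cancelˡ-≡ (ν 0) _ 0
               (trans (sym enc-c) (trans e (sym (ℕ.+-identityʳ (ν 0)))))))
      (λ e → trans enc-c (trans (cong (λ v → ν 0 + double v) e) (ℕ.+-identityʳ (ν 0)))))
      where
      enc-c = encodes-counter cs c enc
      Sat-isZero : ∀ c → Sat w q ν (isZero c) ⇔ datum w (counterAt c q) ≡ ν 0
      Sat-isZero zero    = ∈[0,0]-⇔
      Sat-isZero (suc _) = ⇔.trans (Sat-𝐗 w q ν (0 ∈ᶜ [0,0])) ∈[0,0]-⇔

    instruction-⇔ : ∀ {l c₁ c₂ c′} → Encodes w (ν 0) q (l , c₁ , c₂) → step M (l , c₁ , c₂) ≡ just c′ →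
                    Sat w q ν (instruction (lookup M l)) ⇔ Encodes w (ν 0) (2 + q) c′
    instruction-⇔ {l} {c₁} {c₂} enc e with lookup M l
    instruction-⇔ {l} {c₁} {c₂} enc refl | inc c j =
      moveAlong-⇔ c j enc refl (sym ([2+m]⊖m≡2 (double (getC c (c₁ , c₂)))))
    instruction-⇔ {l} {c₁} {c₂} enc e | jzdec c j k with getC c (c₁ , c₂) in eᶜ
    instruction-⇔ {l} {c₁} {c₂} enc refl | jzdec c j k | zero =
      ⇔.trans (if-true w q ν (isZero c) (move k 0ℤ 0ℤ) (moveAlong c -[1+ 1 ] j) (local-move k _ _)
                       (from (isZero-⇔ (c₁ , c₂) c enc) eᶜ))
              (move-⇔ k enc (sym (ℤ.n⊖n≡0 (double c₁))) (sym (ℤ.n⊖n≡0 (double c₂))))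
    instruction-⇔ {l} {c₁} {c₂} enc refl | jzdec c j k | suc v =
      ⇔.trans (if-false w q ν (isZero c) (move k 0ℤ 0ℤ) (moveAlong c -[1+ 1 ] j) (local-moveAlong c _ j)
                        (λ z → ℕ.1+n≢0 (trans (sym eᶜ) (to (isZero-⇔ (c₁ , c₂) c enc) z))))
              (moveAlong-⇔ c j enc eᶜ (sym (m⊖[2+m]≡-2 (double v))))

    instruction-halted : ∀ {l cs} → step M (l , cs) ≡ nothing → ¬ Sat w q ν (instruction (lookup M l))
    instruction-halted {l} {c₁ , c₂} e s with lookup M l
    ... | halt = s (Sat-true w q ν)
    instruction-halted {l} {c₁ , c₂} () s | inc c j
    instruction-halted {l} {c₁ , c₂} e  s | jzdec c j k with getC c (c₁ , c₂)
    instruction-halted {l} {c₁ , c₂} () s | jzdec c j k | zero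
    instruction-halted {l} {c₁ , c₂} () s | jzdec c j k | suc _

    ok-⇔ : Sat w q ν ok ⇔ (∀ l → Sat w q ν (labelled l))
    ok-⇔ = Sat-⋀ w q ν labelled

    ¬labelled : ∀ l → ¬ Sat w q ν (labelled l) →
                label l ∈ props w q × ¬ Sat w q ν (instruction (lookup M l))
    ¬labelled l ¬s = decidable-stable (label l ∈? props w q) (λ ¬lab → ¬s (λ (lab , _) → ¬lab lab)) ,
                     (λ s → ¬s (λ (_ , ¬t) → ¬t s))

    ok⇒instruction : ∀ {d₀ l cs} → Encodes w d₀ q (l , cs) → Sat w q ν ok → Sat w q ν (instruction (lookup M l))
    ok⇒instruction {l = l} (encodes p _ _) s =
      ⇒-elim w q ν (prop (label l)) (local-instruction (lookup M l)) p (to ok-⇔ s l)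

    ok⇒successor : ∀ {c c′} → Encodes w (ν 0) q c → step M c ≡ just c′ → Sat w q ν ok →
                   Encodes w (ν 0) (2 + q) c′
    ok⇒successor enc e s = to (instruction-⇔ enc e) (ok⇒instruction enc s)

    ¬ok-at-halt : ∀ {c} → Encodes w (ν 0) q c → step M c ≡ nothing → ¬ Sat w q ν ok
    ¬ok-at-halt enc e s = instruction-halted e (ok⇒instruction enc s)

  InitUn : FormulaUn P
  InitUn = F (prop (label zero) ∧ ((0 ∈ᶜ [0,0]) ∧ X (0 ∈ᶜ [0,0])))

  Init : Formula P
  Init = ⌜ InitUn ⌝

  Sat-Init : ∀ w ν → Sat w 0 ν Init ⇔ (∃[ p ] (0 < p × Encodes w (ν 0) p initial))
  Sat-Init w ν = mk⇔
    (λ (p , 0<p , (lab , s₁ , s₂) , _) →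
       p , 0<p , encodes lab (to at-base s₁) (to at-base (to (Sat-𝐗 w p ν (0 ∈ᶜ [0,0])) s₂)))
    (λ { (p , 0<p , encodes lab e₁ e₂) →
       p , 0<p , (lab , from at-base e₁ , from (Sat-𝐗 w p ν (0 ∈ᶜ [0,0])) (from at-base e₂)) ,
       λ k _ _ → Sat-true w k ν })
    where
    at-base : ∀ {a} → (+ a - + ν 0) ∈I [0,0] ⇔ a ≡ ν 0 + 0
    at-base = ⇔.trans ∈[0,0]-⇔
      (mk⇔ (λ e → trans e (sym (ℕ.+-identityʳ (ν 0)))) (λ e → trans e (ℕ.+-identityʳ (ν 0))))

  Violated : DataWord P → Valuation → Set
  Violated w ν = ∃[ j ] (0 < j × ¬ Sat w j ν ok)

  simulate : ∀ {w ν p} → 0 < p → Encodes w (ν 0) p initial →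
             ∀ t {c} → configuration t ≡ just c → Violated w ν ⊎ Encodes w (ν 0) (double t + p) c
  simulate 0<p enc zero refl = inj₂ enc
  simulate {w} {ν} {p} 0<p enc (suc t) e with configuration-pred t e
  ... | c₀ , eₜ , stepped with simulate 0<p enc t eₜ
  ...   | inj₁ v    = inj₁ v
  ...   | inj₂ enc₀ with sat? w (double t + p) ν local-ok
  ...     | no ¬ok  = inj₁ (double t + p , ℕ.<-≤-trans 0<p (ℕ.m≤n+m p (double t)) , ¬ok)
  ...     | yes ok′ = inj₂ (ok⇒successor w _ ν enc₀ stepped ok′)

  halts⇒violated : Halts M → ∀ w ν → Sat w 0 ν Init → Violated w ν
  halts⇒violated (t , c , eₜ , halted) w ν sᵢ with to (Sat-Init w ν) sᵢ
  ... | p , 0<p , enc with simulate 0<p enc t eₜ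
  ...   | inj₁ v    = v
  ...   | inj₂ encₜ =
    double t + p , ℕ.<-≤-trans 0<p (ℕ.m≤n+m p (double t)) , ¬ok-at-halt w _ ν encₜ halted

  reduction : Formula P → Formula P
  reduction θ = Init ∧ 𝐅 (ok ⇒ θ)

  halts⇒reduction≋Init : Halts M → ∀ θ → reduction θ ≋ Init
  halts⇒reduction≋Init h θ w = mk⇔ proj₁ λ sᵢ →
    let (j , 0<j , ¬ok) = halts⇒violated h w (ν₀ w) sᵢ
    in sᵢ , j , 0<j , (λ (ok′ , _) → ¬ok ok′) , λ k _ _ → Sat-true w k (ν₀ w)

  record EncodesRun (w : DataWord P) (G : ℕ) : Set where
    field
      encodes-run   : ∀ t {c} → configuration t ≡ just c → Encodes w (datum w 0) (G + double t) c
      labels-in-run : ∀ j l → label l ∈ props w j →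
                      ∃[ t ] ∃[ cs ] (j ≡ G + double t × configuration t ≡ just (l , cs))

  instruction-fails⇒halts : ∀ {w G} → EncodesRun w G →
                            ∀ t {l c₁ c₂} → configuration t ≡ just (l , c₁ , c₂) →
                            ¬ Sat w (G + double t) (ν₀ w) (instruction (lookup M l)) → Halts M
  instruction-fails⇒halts {w} {G} run t {l} {c₁} {c₂} eₜ ¬instr with step M (l , c₁ , c₂) in e
  ... | nothing = t , _ , eₜ , e
  ... | just c′ = ⊥-elim (¬instr (from (instruction-⇔ w _ (ν₀ w) (encodes-run t eₜ) e) successor))
    where
    open EncodesRun run
    successor : Encodes w (datum w 0) (2 + (G + double t)) c′
    successor = subst (λ p → Encodes w (datum w 0) p c′) (m+double[1+n] G t)
                      (encodes-run (suc t) (trans (configuration-suc t eₜ) e))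

  ¬ok⇒halts : ∀ {w G} → EncodesRun w G → ∀ j → ¬ Sat w j (ν₀ w) ok → Halts M
  ¬ok⇒halts {w} run j ¬ok with ¬∀⟶∃¬ (suc m) _ (λ l → sat? w j (ν₀ w) (local-labelled l))
                                         (¬ok ∘ from (ok-⇔ w j (ν₀ w)))
  ... | l , ¬s with ¬labelled w j (ν₀ w) l ¬s
  ...   | lab , ¬instr with EncodesRun.labels-in-run run j l lab
  ...     | t , _ , refl , eₜ = instruction-fails⇒halts run t eₜ ¬instr

  cells : Maybe (Config m) → (Subset P × ℕ) × (Subset P × ℕ)
  cells (just (l , c₁ , c₂)) = (⁅ label l ⁆ , c₁) , (Subset.⊥ , c₂)
  cells nothing              = (Subset.⊥ , 0) , (Subset.⊥ , 0)

  runFrom : ℕ → ℕ → Subset P × ℕ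
  runFrom t zero          = proj₁ (cells (configuration t))
  runFrom t (suc zero)    = proj₂ (cells (configuration t))
  runFrom t (suc (suc q)) = runFrom (suc t) q

  runFrom-double : ∀ u t → runFrom u (double t) ≡ runFrom (t + u) 0
  runFrom-double u zero    = refl
  runFrom-double u (suc t) = trans (runFrom-double (suc u) t) (cong (λ v → runFrom v 0) (ℕ.+-suc t u))

  runFrom-double+1 : ∀ u t → runFrom u (suc (double t)) ≡ runFrom (t + u) 1
  runFrom-double+1 u zero    = refl
  runFrom-double+1 u (suc t) = trans (runFrom-double+1 (suc u) t) (cong (λ v → runFrom v 1) (ℕ.+-suc t u))

  ∈-runFrom : ∀ u q {x} → x ∈ proj₁ (runFrom u q) →
              ∃[ t ] ∃[ l ] ∃[ cs ] (q ≡ double t × configuration (t + u) ≡ just (l , cs) × x ≡ label l)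
  ∈-runFrom u zero x∈ with configuration u in eᵤ
  ... | just (l , cs) = 0 , l , cs , refl , eᵤ , x∈⁅y⁆⇒x≡y _ x∈
  ... | nothing       = ⊥-elim (∉⊥ x∈)
  ∈-runFrom u (suc zero) x∈ with configuration u
  ... | just _  = ⊥-elim (∉⊥ x∈)
  ... | nothing = ⊥-elim (∉⊥ x∈)
  ∈-runFrom u (suc (suc q)) x∈ with ∈-runFrom (suc u) q x∈
  ... | t , l , cs , refl , eₜ , refl =
    suc t , l , cs , refl , subst (λ v → configuration v ≡ just (l , cs)) (ℕ.+-suc t u) eₜ , refl

  -- Counters are stored raw; `mapData double` turns this into an encoding.
  runWord : ℕ → (ℕ → Subset P × ℕ) → DataWord P
  runWord G pre = wordOf (splice G pre (runFrom 0))

  runFrom-configuration : ∀ t → (runFrom 0 (double t) , runFrom 0 (suc (double t))) ≡ cells (configuration t)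
  runFrom-configuration t = trans (cong₂ _,_ (runFrom-double 0 t) (runFrom-double+1 0 t))
                                  (cong (λ v → runFrom v 0 , runFrom v 1) (ℕ.+-identityʳ t))

  encodesRun : ∀ {G pre} → 0 < G → proj₂ (pre 0) ≡ 0 → (∀ p l → label l ∈ proj₁ (pre p) → ⊥) →
               EncodesRun (mapData double (runWord G pre)) G
  encodesRun {G} {pre} 0<G d₀≡0 unlabelled = record { encodes-run = encodes-run ; labels-in-run = labels-in-run }
    where
    W = mapData double (runWord G pre)
    letter = splice G pre (runFrom 0)
    open SpliceLemmas {G = G} {u = pre} {v = runFrom 0}

    datum₀ : datum W 0 ≡ 0
    datum₀ = cong double (trans (cong proj₂ (splice-< 0<G)) d₀≡0)

    encodes-run : ∀ t {c} → configuration t ≡ just c → Encodes W (datum W 0) (G + double t) c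
    encodes-run t {l , c₁ , c₂} eₜ = encodes
      (subst (label l ∈_) (sym (cong proj₁ first)) (x∈⁅x⁆ (label l)))
      (trans (cong (double ∘ proj₂) first) (cong (_+ double c₁) (sym datum₀)))
      (trans (cong (double ∘ proj₂) second) (cong (_+ double c₂) (sym datum₀)))
      where
      both = trans (runFrom-configuration t) (cong cells eₜ)
      first : letter (G + double t) ≡ (⁅ label l ⁆ , c₁)
      first = trans (splice-+ (double t)) (cong proj₁ both)
      second : letter (suc (G + double t)) ≡ (Subset.⊥ , c₂)
      second = trans (cong letter (sym (ℕ.+-suc G (double t))))
                     (trans (splice-+ (suc (double t))) (cong proj₂ both))

    labels-in-run : ∀ j l → label l ∈ props W j →
                    ∃[ t ] ∃[ cs ] (j ≡ G + double t × configuration t ≡ just (l , cs))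
    labels-in-run j l lab with ℕ.<-≤-connex j G
    ... | inj₁ j<G = ⊥-elim (unlabelled j l (subst (label l ∈_) (cong proj₁ (splice-< j<G)) lab))
    ... | inj₂ G≤j with ∈-runFrom 0 (j ∸ G) (subst (label l ∈_) (cong proj₁ (splice-≥ G≤j)) lab)
    ...   | t , _ , cs , e , eₜ , refl =
      t , cs , trans (sym (ℕ.m+[n∸m]≡n G≤j)) (cong (λ x → G + x) e) ,
      trans (sym (cong configuration (ℕ.+-identityʳ t))) eₜ

undecidable-by-reduction : (Pr : (n : ℕ) → Formula n → Set) (red : ∀ {m} → Machine m → Σ ℕ Formula) →
                           (∀ {m} (M : Machine m) → Halts M ⇔ Pr _ (proj₂ (red M))) → UndecidableTPTL Pr
undecidable-by-reduction Pr red correct decide m M =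
  map′ (from (correct M)) (to (correct M)) (decide _ (proj₂ (red M)))

-- TPTL₌ only compares data for equality

↦-map : ∀ (f : ℕ → ℕ) {ν ν′ : Valuation} → (∀ r → ν′ r ≡ f (ν r)) →
        ∀ x {d d′} → d′ ≡ f d → ∀ r → (ν′ [ x ↦ d′ ]) r ≡ f ((ν [ x ↦ d ]) r)
↦-map f h x e r with x ℕ.≟ r
... | yes _ = e
... | no  _ = h r

module _ {f : ℕ → ℕ} (f-injective : Injective _≡_ _≡_ f) (w : DataWord n) where

  Sat-mapData : IsTPTL₌ φ → ∀ i ν ν′ → (∀ r → ν′ r ≡ f (ν r)) → Sat w i ν φ ⇔ Sat (mapData f w) i ν′ φ
  Sat-mapData (prop p)     i ν ν′ h = ⇔.refl
  Sat-mapData (eq x)       i ν ν′ h = ⇔.trans ∈[0,0]-⇔ (⇔.trans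
    (mk⇔ (λ e → trans (cong f e) (sym (h x))) (λ e → f-injective (trans e (h x)))) (⇔.sym ∈[0,0]-⇔))
  Sat-mapData (neg d)      i ν ν′ h = let e = Sat-mapData d i ν ν′ h in
    mk⇔ (λ ¬s s → ¬s (from e s)) (λ ¬s s → ¬s (to e s))
  Sat-mapData (conj d d′)  i ν ν′ h = Sat-mapData d i ν ν′ h ×-⇔ Sat-mapData d′ i ν ν′ h
  Sat-mapData (until d d′) i ν ν′ h = mk⇔
    (λ (j , i<j , s , between) → j , i<j , to (IH d′ j) s , λ k i<k k<j → to (IH d k) (between k i<k k<j))
    (λ (j , i<j , s , between) → j , i<j , from (IH d′ j) s , λ k i<k k<j → from (IH d k) (between k i<k k<j))
    where
    IH : ∀ {χ} → IsTPTL₌ χ → ∀ k → Sat w k ν χ ⇔ Sat (mapData f w) k ν′ χ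
    IH d k = Sat-mapData d k ν ν′ h
  Sat-mapData (frz x d)    i ν ν′ h = Sat-mapData d i _ _ (↦-map f h x refl)

  ⊨-mapData : IsTPTL₌ φ → w ⊨ φ ⇔ mapData f w ⊨ φ
  ⊨-mapData d = Sat-mapData d 0 (ν₀ w) (ν₀ (mapData f w)) (λ _ → refl)

module FirstReduction {m : ℕ} (M : Machine m) where
  open Encoding M

  θ₁ : Formula P
  θ₁ = 0 ∈ᶜ point (+ 1)

  φ₁ : Formula P
  φ₁ = reduction θ₁

  true₌ : Formula P
  true₌ = ~ ((0 ∈ᶜ [0,0]) ∧ (~ (0 ∈ᶜ [0,0])))

  Init₌ : Formula P
  Init₌ = true₌ U (prop (label zero) ∧ ((0 ∈ᶜ [0,0]) ∧ ((~ true₌) U (0 ∈ᶜ [0,0]))))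

  isTPTL₌-Init₌ : IsTPTL₌ Init₌
  isTPTL₌-Init₌ = until ⊤₌ (conj (prop _) (conj (eq 0) (until (neg ⊤₌) (eq 0))))
    where ⊤₌ = neg (conj (eq 0) (neg (eq 0)))

  Init≋Init₌ : Init ≋ Init₌
  Init≋Init₌ w = mk⇔
    (λ (j , 0<j , (lab , s₁ , (k , j<k , s₂ , between₂)) , _) →
       j , 0<j ,
       (lab , s₁ , (k , j<k , s₂ , λ i j<i i<k → ⊥-elim (between₂ i j<i i<k (Sat-true w i (ν₀ w))))) ,
       λ _ _ _ (s , ¬s) → ¬s s)
    (λ (j , 0<j , (lab , s₁ , (k , j<k , s₂ , between₂)) , _) →
       j , 0<j , (lab , s₁ , (k , j<k , s₂ , λ i j<i i<k _ → between₂ i j<i i<k (λ (s , ¬s) → ¬s s))) ,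
       λ i _ _ → Sat-true w i (ν₀ w))

  prefix₁ : ℕ → Subset P × ℕ
  prefix₁ zero    = Subset.⊥ , 0
  prefix₁ (suc _) = Subset.⊥ , 1

  W₁ : DataWord P
  W₁ = runWord 2 prefix₁

  W₁⊨φ₁ : W₁ ⊨ φ₁
  W₁⊨φ₁ = from (Sat-Init W₁ (ν₀ W₁)) (2 , s≤s z≤n , encodes (x∈⁅x⁆ (label zero)) refl refl) ,
           (1 , s≤s z≤n , (λ (_ , ¬θ) → ¬θ (from ∈-point refl)) , λ k _ _ → Sat-true W₁ k (ν₀ W₁))

  W₁′ : DataWord P
  W₁′ = mapData double W₁

  W₁′-¬θ₁ : ∀ j → ¬ Sat W₁′ j (ν₀ W₁′) θ₁
  W₁′-¬θ₁ j θ = double≢1 (datum W₁ j) (to (offset-⇔ 0 0 1 refl) (to ∈-point θ))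

  equivalent⇒halts : EquivToTPTL₌ φ₁ → Halts M
  equivalent⇒halts (ψ , isψ , φ₁≋ψ)
    with from (φ₁≋ψ W₁′) (to (⊨-mapData double-injective W₁ isψ) (to (φ₁≋ψ W₁) W₁⊨φ₁))
  ... | _ , j , _ , ok⇒θ₁ , _ =
    ¬ok⇒halts (encodesRun (s≤s z≤n) refl λ { zero _ → ∉⊥ ; (suc _) _ → ∉⊥ }) j
              (λ ok′ → ok⇒θ₁ (ok′ , W₁′-¬θ₁ j))

  halts⇔equivalent : Halts M ⇔ EquivToTPTL₌ φ₁
  halts⇔equivalent = mk⇔
    (λ h → Init₌ , isTPTL₌-Init₌ , λ w → ⇔.trans (halts⇒reduction≋Init h θ₁ w) (Init≋Init₌ w))
    equivalent⇒halts

-- An Ehrenfeucht–Fraïssé game for TPTL_un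

depth : FormulaUn n → ℕ
depth (prop _)  = 0
depth (~ φ)     = depth φ
depth (_ ∈ᶜ _)  = 0
depth (φ ∧ ψ)   = depth φ ℕ.⊔ depth ψ
depth (F φ)     = suc (depth φ)
depth (X φ)     = suc (depth φ)
depth (frz _ φ) = depth φ

-- A winning strategy for the duplicator in the game whose moves are 𝐗 and 𝐅 steps.
record Duplicator (w w′ : DataWord n) : Set₁ where
  field
    _∼[_]_      : ℕ → ℕ → ℕ → Set
    same-props  : ∀ {N i i′} → i ∼[ N ] i′ → props w i ≡ props w′ i′
    same-datum  : ∀ {N i i′} → i ∼[ N ] i′ → datum w i ≡ datum w′ i′
    ∼-next      : ∀ {N i i′} → i ∼[ suc N ] i′ → suc i ∼[ N ] suc i′
    ∼-forth     : ∀ {N i i′} → i ∼[ suc N ] i′ → ∀ j → i < j → ∃[ j′ ] (i′ < j′ × j ∼[ N ] j′)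
    ∼-back      : ∀ {N i i′} → i ∼[ suc N ] i′ → ∀ j′ → i′ < j′ → ∃[ j ] (i < j × j ∼[ N ] j′)

module _ {w w′ : DataWord n} (D : Duplicator w w′) where
  open Duplicator D

  Sat-Duplicator : ∀ (φ : FormulaUn n) {N i i′ ν ν′} → depth φ ≤ N → i ∼[ N ] i′ → (∀ r → ν r ≡ ν′ r) →
                   Sat w i ν ⌜ φ ⌝ ⇔ Sat w′ i′ ν′ ⌜ φ ⌝
  Sat-Duplicator (prop p) _ i∼i′ _ =
    mk⇔ (subst (p ∈_) (same-props i∼i′)) (subst (p ∈_) (sym (same-props i∼i′)))
  Sat-Duplicator (~ φ) d i∼i′ ν≗ν′ = let e = Sat-Duplicator φ d i∼i′ ν≗ν′ in
    mk⇔ (λ ¬s s → ¬s (from e s)) (λ ¬s s → ¬s (to e s))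
  Sat-Duplicator (x ∈ᶜ I) _ i∼i′ ν≗ν′ =
    mk⇔ (subst (_∈I I) difference) (subst (_∈I I) (sym difference))
    where difference = cong₂ (λ a b → + a - + b) (same-datum i∼i′) (ν≗ν′ x)
  Sat-Duplicator (φ ∧ ψ) d i∼i′ ν≗ν′ =
    Sat-Duplicator φ (ℕ.m⊔n≤o⇒m≤o (depth φ) (depth ψ) d) i∼i′ ν≗ν′ ×-⇔
    Sat-Duplicator ψ (ℕ.m⊔n≤o⇒n≤o (depth φ) (depth ψ) d) i∼i′ ν≗ν′
  Sat-Duplicator (F φ) {suc N} {i} {i′} {ν} {ν′} (s≤s d) i∼i′ ν≗ν′ = mk⇔
    (λ (j , i<j , s , _) → let (j′ , i′<j′ , j∼j′) = ∼-forth i∼i′ j i<j in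
       j′ , i′<j′ , to (Sat-Duplicator φ d j∼j′ ν≗ν′) s , λ k _ _ → Sat-true w′ k ν′)
    (λ (j′ , i′<j′ , s , _) → let (j , i<j , j∼j′) = ∼-back i∼i′ j′ i′<j′ in
       j , i<j , from (Sat-Duplicator φ d j∼j′ ν≗ν′) s , λ k _ _ → Sat-true w k ν)
  Sat-Duplicator (X φ) {suc N} {i} {i′} {ν} {ν′} (s≤s d) i∼i′ ν≗ν′ =
    ⇔.trans (Sat-𝐗 w i ν ⌜ φ ⌝)
      (⇔.trans (Sat-Duplicator φ d (∼-next i∼i′) ν≗ν′) (⇔.sym (Sat-𝐗 w′ i′ ν′ ⌜ φ ⌝)))
  Sat-Duplicator (frz x φ) d i∼i′ ν≗ν′ =
    Sat-Duplicator φ d i∼i′ (↦-map (λ d → d) ν≗ν′ x (same-datum i∼i′))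

data Marker : Set where
  𝖼 𝖽 𝖻 : Marker

cyclic : ℕ → Marker
cyclic 0                   = 𝖼
cyclic 1                   = 𝖽
cyclic 2                   = 𝖻
cyclic (suc (suc (suc ℓ))) = cyclic ℓ

cyclic-+3 : ∀ ℓ → cyclic (ℓ + 3) ≡ cyclic ℓ
cyclic-+3 ℓ = cong cyclic (ℕ.+-comm ℓ 3)

cyclic-𝖼𝖽 : ∀ ℓ → cyclic ℓ ≡ 𝖼 → cyclic (suc ℓ) ≡ 𝖽
cyclic-𝖼𝖽 0                   _  = refl
cyclic-𝖼𝖽 (suc (suc (suc ℓ))) e = cyclic-𝖼𝖽 ℓ e

cyclic-3* : ∀ k → cyclic (3 ℕ.* k) ≡ 𝖼
cyclic-3* zero    = refl
cyclic-3* (suc k) = trans (cong cyclic (ℕ.*-suc 3 k)) (cyclic-3* k)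

cyclic-within-3 : ∀ ℓ x → ∃[ i ] (i ≤ 2 × cyclic (ℓ + i) ≡ x)
cyclic-within-3 0 𝖼 = 0 , z≤n , refl
cyclic-within-3 0 𝖽 = 1 , s≤s z≤n , refl
cyclic-within-3 0 𝖻 = 2 , s≤s (s≤s z≤n) , refl
cyclic-within-3 1 𝖼 = 2 , s≤s (s≤s z≤n) , refl
cyclic-within-3 1 𝖽 = 0 , z≤n , refl
cyclic-within-3 1 𝖻 = 1 , s≤s z≤n , refl
cyclic-within-3 2 𝖼 = 1 , s≤s z≤n , refl
cyclic-within-3 2 𝖽 = 2 , s≤s (s≤s z≤n) , refl
cyclic-within-3 2 𝖻 = 0 , z≤n , refl
cyclic-within-3 (suc (suc (suc ℓ))) x = cyclic-within-3 ℓ x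

Recurrent : (ℕ → Marker) → Set
Recurrent L = ∀ ℓ x → ∃[ ℓ′ ] (2 + ℓ ≤ ℓ′ × ℓ′ ≤ 7 + ℓ × L ℓ′ ≡ x)

cyclic-occurs : ∀ ℓ x → ∃[ p ] (2 + ℓ ≤ p × p + 3 ≤ 7 + ℓ × cyclic p ≡ x)
cyclic-occurs ℓ x with cyclic-within-3 (2 + ℓ) x
... | i , i≤2 , e = (2 + ℓ) + i , ℕ.m≤m+n (2 + ℓ) i , +3-bound , e
  where
  +3-bound : (2 + ℓ) + i + 3 ≤ 7 + ℓ
  +3-bound = ℕ.≤-trans (ℕ.≤-reflexive (ℕ.+-assoc (2 + ℓ) i 3))
               (ℕ.≤-trans (ℕ.+-monoʳ-≤ (2 + ℓ) (ℕ.+-monoˡ-≤ 3 i≤2)) (ℕ.≤-reflexive (ℕ.+-comm (2 + ℓ) 5)))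

cyclic-recurrent : Recurrent cyclic
cyclic-recurrent ℓ x with cyclic-occurs ℓ x
... | p , lo , hi , e = p , lo , ℕ.≤-trans (ℕ.m≤m+n p 3) hi , e

swapped : ℕ → ℕ → Marker
swapped s ℓ with ℓ ℕ.≟ s
... | yes _ = 𝖻
... | no  _ with ℓ ℕ.≟ suc s
...   | yes _ = 𝖽
...   | no  _ = cyclic ℓ

module _ (s : ℕ) where

  swapped-at : swapped s s ≡ 𝖻
  swapped-at with s ℕ.≟ s
  ... | yes _   = refl
  ... | no  s≢s = ⊥-elim (s≢s refl)

  swapped-elsewhere : ∀ {ℓ} → ℓ ≢ s → ℓ ≢ suc s → swapped s ℓ ≡ cyclic ℓ
  swapped-elsewhere {ℓ} ℓ≢s ℓ≢1+s with ℓ ℕ.≟ s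
  ... | yes ℓ≡s = ⊥-elim (ℓ≢s ℓ≡s)
  ... | no  _ with ℓ ℕ.≟ suc s
  ...   | yes ℓ≡1+s = ⊥-elim (ℓ≢1+s ℓ≡1+s)
  ...   | no  _     = refl

  swapped-below : ∀ {ℓ} → ℓ < s → swapped s ℓ ≡ cyclic ℓ
  swapped-below {ℓ} ℓ<s = swapped-elsewhere {ℓ} (λ { refl → ℕ.<-irrefl refl ℓ<s })
                                        (λ { refl → ℕ.<-asym ℓ<s (ℕ.n<1+n s) })

  swapped-above : ∀ {ℓ} → 2 + s ≤ ℓ → swapped s ℓ ≡ cyclic ℓ
  swapped-above {ℓ} 2+s≤ℓ =
    swapped-elsewhere {ℓ} (λ { refl → ℕ.<⇒≱ (ℕ.≤-trans (ℕ.n≤1+n _) 2+s≤ℓ) ℕ.≤-refl })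
                          (λ { refl → ℕ.<-irrefl refl 2+s≤ℓ })

  swapped-three-later : ∀ {ℓ x} p → 2 + ℓ ≤ p → p + 3 ≤ 7 + ℓ → cyclic p ≡ x → s ≤ p →
                        ∃[ ℓ′ ] (2 + ℓ ≤ ℓ′ × ℓ′ ≤ 7 + ℓ × swapped s ℓ′ ≡ x)
  swapped-three-later p lo hi e s≤p = p + 3 , ℕ.≤-trans lo (ℕ.m≤m+n p 3) , hi ,
    trans (swapped-above {p + 3} (ℕ.≤-trans (ℕ.+-monoʳ-≤ 2 s≤p)
                                            (ℕ.≤-trans (ℕ.n≤1+n _) (ℕ.≤-reflexive (ℕ.+-comm 3 p)))))
          (trans (cyclic-+3 p) e)

  swapped-recurrent : Recurrent (swapped s)
  swapped-recurrent ℓ x with cyclic-occurs ℓ x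
  ... | p , lo , hi , e with p ℕ.≟ s | p ℕ.≟ suc s
  ...   | no p≢s  | no p≢1+s  =
    p , lo , ℕ.≤-trans (ℕ.m≤m+n p 3) hi , trans (swapped-elsewhere {p} p≢s p≢1+s) e
  ...   | yes p≡s | _         = swapped-three-later p lo hi e (ℕ.≤-reflexive (sym p≡s))
  ...   | no _    | yes p≡1+s =
    swapped-three-later p lo hi e (ℕ.≤-trans (ℕ.n≤1+n s) (ℕ.≤-reflexive (sym p≡1+s)))

module SecondReduction {m : ℕ} (M : Machine m) where
  open Encoding M

  a : Fin P
  a = zero

  marker : Marker → Fin P
  marker 𝖻 = suc zero
  marker 𝖼 = suc (suc zero)
  marker 𝖽 = suc (suc (suc zero))

  θ₂ : Formula P
  θ₂ = prop (marker 𝖼) ∧ (prop a U prop (marker 𝖻))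

  φ₂ : Formula P
  φ₂ = reduction θ₂

  ∉⁅_⁆ : ∀ {x} (y : Fin P) → x ≢ y → x ∈ ⁅ y ⁆ → ⊥
  ∉⁅ y ⁆ x≢y x∈ = x≢y (x∈⁅y⁆⇒x≡y y x∈)

  ∈-marker : ∀ {x} y → marker x ∈ ⁅ marker y ⁆ → x ≡ y
  ∈-marker {x} y x∈ = injective x y (x∈⁅y⁆⇒x≡y (marker y) x∈)
    where
    injective : ∀ x y → marker x ≡ marker y → x ≡ y
    injective 𝖻 𝖻 _ = refl
    injective 𝖼 𝖼 _ = refl
    injective 𝖽 𝖽 _ = refl

  blockLetter : (ℕ → Marker) → ℕ → ℕ → Subset P
  blockLetter L zero    ℓ = ⁅ marker (L ℓ) ⁆
  blockLetter L (suc _) ℓ = ⁅ a ⁆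

  blockLetter-cong : ∀ {L₁ L₂ o ℓ ℓ′} → (o ≡ 0 → L₁ ℓ ≡ L₂ ℓ′) →
                     blockLetter L₁ o ℓ ≡ blockLetter L₂ o ℓ′
  blockLetter-cong {o = zero}  e = cong (⁅_⁆ ∘ marker) (e refl)
  blockLetter-cong {o = suc _} e = refl

  blockLetter-unlabelled : ∀ L o ℓ l → label l ∈ blockLetter L o ℓ → ⊥
  blockLetter-unlabelled L zero ℓ l with L ℓ
  ... | 𝖻 = ∉⁅ marker 𝖻 ⁆ λ ()
  ... | 𝖼 = ∉⁅ marker 𝖼 ⁆ λ ()
  ... | 𝖽 = ∉⁅ marker 𝖽 ⁆ λ ()
  blockLetter-unlabelled L (suc _) ℓ l = ∉⁅ a ⁆ λ ()

  -- The prefix consists of 3 + 2T blocks of length sn, each a marker followed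
  -- by pad letters a; the run of M follows.  T is a multiple of 3, so block T
  -- carries 𝖼, followed by 𝖽 in the cyclic word but by 𝖻 in the swapped one;
  -- from block 3 + T (position E) on the two words agree.  A play with N rounds
  -- left stays R N blocks away from the end of the prefix.
  module Words (N₀ : ℕ) where
    open ℕ.≤-Reasoning

    pad sn T E G : ℕ
    pad = 2 + N₀
    sn  = suc pad
    T   = 3 * (pad * 10)
    E   = (3 + T) * sn
    G   = (3 + T + T) * sn

    R : ℕ → ℕ
    R N = suc N * 10

    record Rich (N p : ℕ) : Set where
      constructor rich
      field room : p + R N * sn ≤ G

    prefix : (ℕ → Marker) → ℕ → Subset P × ℕ
    prefix L p = blockLetter L (p % sn) (p / sn) , 0

    letters : (ℕ → Marker) → ℕ → Subset P × ℕ
    letters L = splice G (prefix L) (runFrom 0)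

    word : (ℕ → Marker) → DataWord P
    word L = mapData double (runWord G (prefix L))

    decompose : ∀ p → ∃[ o ] ∃[ ℓ ] (o < sn × p ≡ o + ℓ * sn)
    decompose p = p % sn , p / sn , m%n<n p sn , m≡m%n+[m/n]*n p sn

    %-/-block : ∀ {o} ℓ → o < sn → (o + ℓ * sn) % sn ≡ o × (o + ℓ * sn) / sn ≡ ℓ
    %-/-block {o} ℓ o<sn = %≡o , sym (ℕ.*-cancelʳ-≡ ℓ _ sn (ℕ.+-cancelˡ-≡ o _ _ (begin-equality
        o + ℓ * sn                                   ≡⟨ m≡m%n+[m/n]*n (o + ℓ * sn) sn ⟩
        (o + ℓ * sn) % sn + (o + ℓ * sn) / sn * sn    ≡⟨ cong (_+ (o + ℓ * sn) / sn * sn) %≡o ⟩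
        o + (o + ℓ * sn) / sn * sn                    ∎)))
      where
      %≡o : (o + ℓ * sn) % sn ≡ o
      %≡o = trans ([m+kn]%n≡m%n o ℓ sn) (m<n⇒m%n≡m o<sn)

    module Letters (L : ℕ → Marker) = SpliceLemmas {G = G} {u = prefix L} {v = runFrom 0}

    letters-prefix : ∀ L {o} ℓ → o < sn → o + ℓ * sn < G →
                     letters L (o + ℓ * sn) ≡ (blockLetter L o ℓ , 0)
    letters-prefix L ℓ o<sn in-prefix =
      trans (Letters.splice-< L in-prefix) (cong₂ (λ o ℓ → blockLetter L o ℓ , 0) o≡ ℓ≡)
      where
      o≡ = proj₁ (%-/-block ℓ o<sn)
      ℓ≡ = proj₂ (%-/-block ℓ o<sn)

    block-< : ∀ {o o′ ℓ ℓ′} → o < sn → ℓ < ℓ′ → o + ℓ * sn < o′ + ℓ′ * sn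
    block-< {o} {o′} {ℓ} {ℓ′} o<sn ℓ<ℓ′ = begin-strict
      o + ℓ * sn    <⟨ ℕ.+-monoˡ-< (ℓ * sn) o<sn ⟩
      suc ℓ * sn    ≤⟨ ℕ.*-monoˡ-≤ sn ℓ<ℓ′ ⟩
      ℓ′ * sn       ≤⟨ ℕ.m≤n+m (ℓ′ * sn) o′ ⟩
      o′ + ℓ′ * sn  ∎

    within-ten-blocks : ∀ {o ℓ ℓ′} → ℓ′ ≤ 7 + ℓ → ℓ′ * sn ≤ (o + ℓ * sn) + 10 * sn
    within-ten-blocks {o} {ℓ} {ℓ′} ℓ′≤7+ℓ = begin
      ℓ′ * sn                  ≤⟨ ℕ.*-monoˡ-≤ sn ℓ′≤7+ℓ ⟩
      (7 + ℓ) * sn             ≤⟨ ℕ.*-monoˡ-≤ sn (ℕ.+-monoˡ-≤ ℓ (ℕ.m≤m+n 7 3)) ⟩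
      (10 + ℓ) * sn            ≡⟨ ℕ.*-distribʳ-+ sn 10 ℓ ⟩
      10 * sn + ℓ * sn         ≡⟨ ℕ.+-comm (10 * sn) (ℓ * sn) ⟩
      ℓ * sn + 10 * sn         ≤⟨ ℕ.+-monoˡ-≤ (10 * sn) (ℕ.m≤n+m (ℓ * sn) o) ⟩
      (o + ℓ * sn) + 10 * sn   ∎

    rich-shift : ∀ N {p q} → q ≤ p + 10 * sn → Rich (suc N) p → Rich N q
    rich-shift N {p} {q} q≤ (rich room) = rich $ begin
      q + R N * sn                ≤⟨ ℕ.+-monoˡ-≤ (R N * sn) q≤ ⟩
      (p + 10 * sn) + R N * sn    ≡⟨ ℕ.+-assoc p (10 * sn) (R N * sn) ⟩
      p + (10 * sn + R N * sn)    ≡⟨ cong (λ x → p + x) (sym (ℕ.*-distribʳ-+ sn 10 (R N))) ⟩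
      p + R (suc N) * sn          ≤⟨ room ⟩
      G                           ∎

    rich-next : ∀ N {p} → Rich (suc N) p → Rich N (suc p)
    rich-next N {p} = rich-shift N (ℕ.≤-trans (ℕ.≤-reflexive (ℕ.+-comm 1 p)) (ℕ.+-monoʳ-≤ p (s≤s z≤n)))

    rich⇒prefix : ∀ N {p} → Rich N p → p < G
    rich⇒prefix N {p} (rich room) = ℕ.<-≤-trans (ℕ.m<m+n p (s≤s z≤n)) room

    R≤T : ∀ {N} → N < pad → R N ≤ T
    R≤T N<pad = ℕ.≤-trans (ℕ.*-monoˡ-≤ 10 N<pad) (ℕ.m≤n*m (pad * 10) 3)

    beyond-rich : ∀ {N} → N < pad → E + R N * sn ≤ G
    beyond-rich {N} N<pad = begin
      E + R N * sn           ≡⟨ sym (ℕ.*-distribʳ-+ sn (3 + T) (R N)) ⟩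
      ((3 + T) + R N) * sn   ≤⟨ ℕ.*-monoˡ-≤ sn (ℕ.+-monoʳ-≤ (3 + T) (R≤T N<pad)) ⟩
      G                      ∎

    -- Positions at the same offset o in blocks ℓ and ℓ′ whose markers agree,
    -- and so do the next ones if they can be reached in the N rounds left.
    data Similar (L₁ L₂ : ℕ → Marker) (N : ℕ) : ℕ → ℕ → Set where
      beyond  : ∀ {p} → E ≤ p → Similar L₁ L₂ N p p
      aligned : ∀ {o ℓ ℓ′} → N < pad → Rich N (o + ℓ * sn) → Rich N (o + ℓ′ * sn) → o < sn →
                (o ≡ 0 → L₁ ℓ ≡ L₂ ℓ′) → (sn ≤ o + N → L₁ (suc ℓ) ≡ L₂ (suc ℓ′)) →
                Similar L₁ L₂ N (o + ℓ * sn) (o + ℓ′ * sn)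

    module _ {L₁ L₂ : ℕ → Marker} where

      similar-flip : ∀ {N p p′} → Similar L₁ L₂ N p p′ → Similar L₂ L₁ N p′ p
      similar-flip (beyond E≤p)                       = beyond E≤p
      similar-flip (aligned N<pad ρ ρ′ o<sn c₀ c₁) = aligned N<pad ρ′ ρ o<sn (sym ∘ c₀) (sym ∘ c₁)

      similar-letters : (∀ ℓ → 3 + T ≤ ℓ → L₁ ℓ ≡ L₂ ℓ) →
                        ∀ {N p p′} → Similar L₁ L₂ N p p′ → letters L₁ p ≡ letters L₂ p′
      similar-letters agree {p = p} (beyond E≤p) with ℕ.<-≤-connex p G
      ... | inj₁ p<G = trans (Letters.splice-< L₁ p<G)
                             (trans (cong (_, 0) (blockLetter-cong {L₁} {L₂} {p % sn} (λ _ → agree _ late)))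
                                    (sym (Letters.splice-< L₂ p<G)))
        where
        late : 3 + T ≤ p / sn
        late = ℕ.≤-trans (ℕ.≤-reflexive (sym (m*n/n≡m (3 + T) sn))) (/-monoˡ-≤ sn E≤p)
      ... | inj₂ G≤p = trans (Letters.splice-≥ L₁ G≤p) (sym (Letters.splice-≥ L₂ G≤p))
      similar-letters agree {N} (aligned {ℓ = ℓ} {ℓ′} N<pad ρ ρ′ o<sn c₀ _) =
        trans (letters-prefix L₁ ℓ o<sn (rich⇒prefix N ρ))
              (trans (cong (_, 0) (blockLetter-cong c₀))
                     (sym (letters-prefix L₂ ℓ′ o<sn (rich⇒prefix N ρ′))))

      similar-next : ∀ {N p p′} → Similar L₁ L₂ (suc N) p p′ → Similar L₁ L₂ N (suc p) (suc p′)
      similar-next (beyond E≤p) = beyond (ℕ.≤-trans E≤p (ℕ.n≤1+n _))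
      similar-next {N} (aligned {o} N<pad ρ ρ′ o<sn c₀ c₁) with ℕ.m<1+n⇒m<n∨m≡n o<sn
      ... | inj₁ o<pad = aligned N<pad′ (rich-next N ρ) (rich-next N ρ′) (s≤s o<pad) (λ ())
                                 (λ sn≤ → c₁ (ℕ.≤-trans sn≤ (ℕ.≤-reflexive (sym (ℕ.+-suc o N)))))
        where N<pad′ = ℕ.<-trans (ℕ.n<1+n N) N<pad
      ... | inj₂ refl  = aligned N<pad′ (rich-next N ρ) (rich-next N ρ′) (s≤s z≤n)
                                 (λ _ → c₁ (ℕ.≤-trans (s≤s (ℕ.m≤m+n pad N))
                                                      (ℕ.≤-reflexive (sym (ℕ.+-suc pad N)))))
                                 (λ sn≤N → ⊥-elim (ℕ.<⇒≱ (ℕ.<-trans N<pad′ (ℕ.n<1+n pad)) sn≤N))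
        where N<pad′ = ℕ.<-trans (ℕ.n<1+n N) N<pad

      -- Answer at the same offset in a block at most seven blocks ahead whose
      -- relevant marker agrees; recurrence of L₂ provides one.
      forth-aligned : Recurrent L₂ → ∀ {N o′ ℓ′} → N < pad → Rich (suc N) (o′ + ℓ′ * sn) → o′ < sn →
                      ∀ {o} ℓ → o < sn → Rich N (o + ℓ * sn) →
                      ∃[ j′ ] (o′ + ℓ′ * sn < j′ × Similar L₁ L₂ N (o + ℓ * sn) j′)
      forth-aligned recurrent {N} {ℓ′ = ℓ′} N<pad ρ′ o′<sn {zero} ℓ o<sn ρ
        with recurrent ℓ′ (L₁ ℓ)
      ... | ℓ₂ , lo , hi , e =
        ℓ₂ * sn , block-< o′<sn (ℕ.≤-trans (ℕ.n≤1+n _) lo) ,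
        aligned N<pad ρ (rich-shift N (within-ten-blocks hi) ρ′) o<sn (λ _ → sym e)
                (λ sn≤N → ⊥-elim (ℕ.<⇒≱ (ℕ.<-trans N<pad (ℕ.n<1+n pad)) sn≤N))
      forth-aligned recurrent {N} {ℓ′ = ℓ′} N<pad ρ′ o′<sn {suc o} ℓ o<sn ρ
        with recurrent ℓ′ (L₁ (suc ℓ))
      ... | suc ℓ₂ , lo , hi , e =
        suc o + ℓ₂ * sn , block-< o′<sn (ℕ.≤-pred lo) ,
        aligned N<pad ρ (rich-shift N (ℕ.≤-trans (ℕ.<⇒≤ (ℕ.+-monoˡ-< (ℓ₂ * sn) o<sn)) (within-ten-blocks hi)) ρ′)
                o<sn (λ ()) (λ _ → sym e)

      similar-forth : Recurrent L₂ → ∀ {N i i′} → Similar L₁ L₂ (suc N) i i′ →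
                      ∀ j → i < j → ∃[ j′ ] (i′ < j′ × Similar L₁ L₂ N j j′)
      similar-forth _ (beyond E≤i) j i<j = j , i<j , beyond (ℕ.≤-trans E≤i (ℕ.<⇒≤ i<j))
      similar-forth recurrent {N} (aligned {o′} {ℓ′ = ℓ′} N<pad _ ρ′ o′<sn _ _) j _
        with (j + R N * sn) ℕ.≤? G
      ... | yes room with decompose j
      ...   | o , ℓ , o<sn , refl = forth-aligned recurrent {ℓ′ = ℓ′} N<pad′ ρ′ o′<sn ℓ o<sn (rich room)
        where N<pad′ = ℕ.<-trans (ℕ.n<1+n N) N<pad
      similar-forth recurrent {N} (aligned {o′} {ℓ′ = ℓ′} N<pad _ (rich room′) o′<sn _ _) j _
        | no no-room =
        j , i′<j , beyond (ℕ.<⇒≤ E<j)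
        where
        G<j+R : G < j + R N * sn
        G<j+R = ℕ.≰⇒> no-room
        E<j : E < j
        E<j = ℕ.+-cancelʳ-< (R N * sn) E j (ℕ.≤-<-trans (beyond-rich (ℕ.<-trans (ℕ.n<1+n N) N<pad)) G<j+R)
        i′<j : o′ + ℓ′ * sn < j
        i′<j = ℕ.+-cancelʳ-< (R N * sn) _ j
                 (ℕ.≤-<-trans (ℕ.≤-trans (ℕ.+-monoʳ-≤ _ (ℕ.*-monoˡ-≤ sn (ℕ.m≤n+m (R N) 10))) room′)
                              G<j+R)

    runs : ∀ L → EncodesRun (word L) G
    runs L = encodesRun (s≤s z≤n) refl λ p → blockLetter-unlabelled L (p % sn) (p / sn)

    props-prefix : ∀ L {o} ℓ → o < sn → o + ℓ * sn < G →
                   props (word L) (o + ℓ * sn) ≡ blockLetter L o ℓ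
    props-prefix L ℓ o<sn in-prefix = cong proj₁ (letters-prefix L ℓ o<sn in-prefix)

    ∈-prefix : ∀ L {o} ℓ {x} → o < sn → (∀ l → x ≢ label l) →
               x ∈ props (word L) (o + ℓ * sn) → x ∈ blockLetter L o ℓ
    ∈-prefix L {o} ℓ {x} o<sn unlabelled x∈ with ℕ.<-≤-connex (o + ℓ * sn) G
    ... | inj₁ in-prefix = subst (x ∈_) (props-prefix L ℓ o<sn in-prefix) x∈
    ... | inj₂ G≤p
      with ∈-runFrom 0 (o + ℓ * sn ∸ G) (subst (x ∈_) (cong proj₁ (Letters.splice-≥ L G≤p)) x∈)
    ...   | _ , l , _ , _ , _ , x≡l = ⊥-elim (unlabelled l x≡l)

    marker-at : ∀ L ℓ → suc ℓ * sn ≤ G → marker (L ℓ) ∈ props (word L) (ℓ * sn)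
    marker-at L ℓ fits = subst (marker (L ℓ) ∈_)
      (sym (props-prefix L ℓ (s≤s z≤n) (ℕ.<-≤-trans (ℕ.*-monoˡ-< sn (ℕ.n<1+n ℓ)) fits))) (x∈⁅x⁆ _)

    a-inside : ∀ L ℓ k → ℓ * sn < k → k < suc ℓ * sn → suc ℓ * sn ≤ G → a ∈ props (word L) k
    a-inside L ℓ k lo hi fits with k ∸ ℓ * sn | ℕ.m∸n+n≡m (ℕ.<⇒≤ lo)
    ... | zero  | refl = ⊥-elim (ℕ.<-irrefl refl lo)
    ... | suc o | refl = subst (a ∈_) (sym (props-prefix L ℓ o<sn (ℕ.<-≤-trans hi fits))) (x∈⁅x⁆ a)
      where o<sn = ℕ.+-cancelʳ-< (ℓ * sn) (suc o) sn hi

    a∉⁅marker⁆ : ∀ x → a ∈ ⁅ marker x ⁆ → ⊥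
    a∉⁅marker⁆ 𝖻 = ∉⁅ marker 𝖻 ⁆ λ ()
    a∉⁅marker⁆ 𝖼 = ∉⁅ marker 𝖼 ⁆ λ ()
    a∉⁅marker⁆ 𝖽 = ∉⁅ marker 𝖽 ⁆ λ ()

    -- In the cyclic word every 𝖼 is followed, after its letters a, by 𝖽.
    cyclic-¬θ₂ : ∀ j ν → ¬ Sat (word cyclic) j ν θ₂
    cyclic-¬θ₂ j ν (c∈ , j₂ , j<j₂ , b∈ , between) with decompose j | decompose j₂
    ... | suc _ , ℓ , o<sn , refl | _ = ∉⁅ a ⁆ (λ ()) (∈-prefix cyclic ℓ o<sn (λ _ ()) c∈)
    ... | zero , ℓ , _ , refl | suc _ , ℓ₂ , o₂<sn , refl =
      ∉⁅ a ⁆ (λ ()) (∈-prefix cyclic ℓ₂ o₂<sn (λ _ ()) b∈)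
    ... | zero , ℓ , _ , refl | zero , ℓ₂ , _ , refl with ℕ.m≤n⇒m<n∨m≡n (ℕ.*-cancelʳ-< sn ℓ ℓ₂ j<j₂)
    ...   | inj₂ refl = case trans (sym (cyclic-𝖼𝖽 ℓ ℓ-is-𝖼)) ℓ₂-is-𝖻 of λ ()
      where
      ℓ-is-𝖼  = sym (∈-marker {𝖼} (cyclic ℓ) (∈-prefix cyclic ℓ (s≤s z≤n) (λ _ ()) c∈))
      ℓ₂-is-𝖻 = sym (∈-marker {𝖻} (cyclic ℓ₂) (∈-prefix cyclic ℓ₂ (s≤s z≤n) (λ _ ()) b∈))
    ...   | inj₁ 1+ℓ<ℓ₂ = a∉⁅marker⁆ (cyclic (suc ℓ))
              (∈-prefix cyclic (suc ℓ) (s≤s z≤n) (λ _ ())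
                (between (suc ℓ * sn) (ℕ.*-monoˡ-< sn (ℕ.n<1+n ℓ)) (ℕ.*-monoˡ-< sn 1+ℓ<ℓ₂)))

    swap : ℕ → Marker
    swap = swapped (suc T)

    similar₀ : Similar swap cyclic N₀ 0 0
    similar₀ = aligned {o = 0} {0} {0} N₀<pad (rich room₀) (rich room₀) (s≤s z≤n)
                       (λ _ → swapped-below (suc T) (s≤s z≤n))
                       (λ sn≤N₀ → ⊥-elim (ℕ.1+n≰n (ℕ.m+n≤o⇒n≤o 2 sn≤N₀)))
      where
      N₀<pad = ℕ.<-trans (ℕ.n<1+n N₀) (ℕ.n<1+n (suc N₀))
      room₀ : R N₀ * sn ≤ G
      room₀ = ℕ.≤-trans (ℕ.*-monoˡ-≤ sn (R≤T N₀<pad)) (ℕ.*-monoˡ-≤ sn (ℕ.m≤n+m T (3 + T)))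

    duplicator : Duplicator (word swap) (word cyclic)
    duplicator = record
      { _∼[_]_     = λ p N p′ → Similar swap cyclic N p p′
      ; same-props = cong proj₁ ∘ similar-letters (λ _ → swapped-above (suc T))
      ; same-datum = cong (double ∘ proj₂) ∘ similar-letters (λ _ → swapped-above (suc T))
      ; ∼-next     = similar-next
      ; ∼-forth    = similar-forth cyclic-recurrent
      ; ∼-back     = λ i∼i′ j′ i′<j′ →
          let (j , i<j , j′∼j) = similar-forth (swapped-recurrent (suc T)) (similar-flip i∼i′) j′ i′<j′
          in j , i<j , similar-flip j′∼j
      }

    swap⊨φ₂ : word swap ⊨ φ₂
    swap⊨φ₂ = from (Sat-Init W (ν₀ W)) (G + 0 , s≤s z≤n , EncodesRun.encodes-run (runs swap) 0 refl) ,
              T * sn , ℕ.*-monoˡ-< sn {0} {T} (s≤s z≤n) , (λ (_ , ¬θ₂) → ¬θ₂ θ₂-at-T) ,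
              λ k _ _ → Sat-true W k (ν₀ W)
      where
      W = word swap
      fits : suc (suc T) * sn ≤ G
      fits = ℕ.*-monoˡ-≤ sn (s≤s (s≤s (ℕ.≤-trans (ℕ.n≤1+n T) (ℕ.m≤m+n (suc T) T))))
      fits-T : suc T * sn ≤ G
      fits-T = ℕ.≤-trans (ℕ.*-monoˡ-≤ sn (ℕ.n≤1+n (suc T))) fits
      θ₂-at-T : Sat W (T * sn) (ν₀ W) θ₂
      θ₂-at-T =
        subst (λ x → marker x ∈ props W (T * sn))
              (trans (swapped-below (suc T) (ℕ.n<1+n T)) (cyclic-3* (pad * 10))) (marker-at swap T fits-T) ,
        suc T * sn , ℕ.*-monoˡ-< sn (ℕ.n<1+n T) ,
        subst (λ x → marker x ∈ props W (suc T * sn)) (swapped-at (suc T)) (marker-at swap (suc T) fits) ,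
        λ k lo hi → a-inside swap T k lo hi fits-T

    cyclic⊨φ₂⇒halts : word cyclic ⊨ φ₂ → Halts M
    cyclic⊨φ₂⇒halts (_ , j , _ , ok⇒θ₂ , _) =
      ¬ok⇒halts (runs cyclic) j λ ok′ → ok⇒θ₂ (ok′ , cyclic-¬θ₂ j (ν₀ (word cyclic)))

  equivalent⇒halts : EquivToTPTLun φ₂ → Halts M
  equivalent⇒halts (ψ , φ₂≋ψ) = cyclic⊨φ₂⇒halts (from (φ₂≋ψ (word cyclic))
    (to (Sat-Duplicator duplicator ψ ℕ.≤-refl similar₀ λ _ → Duplicator.same-datum duplicator similar₀)
        (to (φ₂≋ψ (word swap)) swap⊨φ₂)))
    where open Words (depth ψ)

  halts⇔equivalent : Halts M ⇔ EquivToTPTLun φ₂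
  halts⇔equivalent = mk⇔ (λ h → InitUn , halts⇒reduction≋Init h θ₂) equivalent⇒halts


proposition8 : UndecidableTPTL (λ n φ → EquivToTPTL₌ φ)
    × UndecidableTPTL (λ n φ → EquivToTPTLun φ)
proposition8 =
  undecidable-by-reduction _ (λ M → _ , FirstReduction.φ₁ M) FirstReduction.halts⇔equivalent ,
  undecidable-by-reduction _ (λ M → _ , SecondReduction.φ₂ M) SecondReduction.halts⇔equivalent
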